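{- If $T$ is a nontrivial tree, then $pc_{1,2}(T)=\sigma'_2(T)-1$.
   Context: All graphs are finite, undirected and simple; a tree is nontrivial if it has at least two vertices. For a graph $G$ with at least one edge, $\sigma'_2(G)=\max\{d(x)+d(y): xy\in E(G)\}$ is the largest sum of degrees of two adjacent vertices. An edge-coloring of a graph is an arbitrary map from its edge set to the natural numbers (adjacent edges may share a color). In an edge-colored graph, a path $P$ is a distance $2$-proper path if no two edges of $P$ of the same color appear with fewer than $2$ edges in between on $P$. The number $pc_{1,2}(G)$ is the minimum number of colors in an edge-coloring of the connected graph $G$ such that every pair of distinct vertices of $G$ is connected by at least one distance $2$-proper path. -}

module Defs where

open import Data.Nat.Base using (ℕ; suc; _+_; _∸_; _≤_)
import Data.Nat.Properties as ℕ
open import Data.Fin.Base using (Fin; toℕ; _<_)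
import Data.Fin.Properties as Fin
open import Data.List.Base
  using (List; []; _∷_; length; lookup; map; filter; deduplicate; allFin; cartesianProduct)
open import Data.List.Extrema.Nat using (max)
open import Data.List.Relation.Unary.Unique.Propositional using (Unique)
open import Data.Product.Base using (_×_; _,_; ∃-syntax; Σ-syntax)
open import Level using (0ℓ)
open import Relation.Binary.Construct.Closure.ReflexiveTransitive using (Star; ε; _◅_)
open import Relation.Binary.Core using (Rel)
open import Relation.Binary.Definitions using (Decidable; Symmetric)
open import Relation.Binary.PropositionalEquality.Core using (_≡_; _≢_)
open import Relation.Nullary.Decidable.Core using (_×-dec_)
open import Relation.Nullary.Negation.Core using (¬_)

record Graph (n : ℕ) : Set₁ where
  infix 4 _~_ _~?_
  field
    _~_    : Rel (Fin n) 0ℓ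
    _~?_   : Decidable _~_
    ~-sym  : Symmetric _~_
    ~-irr  : ∀ {u} → ¬ (u ~ u)

module _ {n : ℕ} (G : Graph n) where
  open Graph G

  degree : Fin n → ℕ
  degree u = length (filter (u ~?_) (allFin n))

  -- Each edge {u , v} is listed exactly once, as the pair with u < v.
  edges : List (Fin n × Fin n)
  edges = filter (λ (u , v) → (u Fin.<? v) ×-dec (u ~? v))
                 (cartesianProduct (allFin n) (allFin n))

  -- The maximum is taken to be 0 when there is no edge.
  σ₂′ : ℕ
  σ₂′ = max 0 (map (λ (x , y) → degree x + degree y) edges)

  Walk : Rel (Fin n) 0ℓ
  Walk = Star _~_

  vertices : ∀ {u v} → Walk u v → List (Fin n)
  vertices {u} ε       = u ∷ []
  vertices {u} (_ ◅ p) = u ∷ vertices p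

  IsPath : ∀ {u v} → Walk u v → Set
  IsPath p = Unique (vertices p)

  Connected : Set
  Connected = ∀ u v → Walk u v

  -- A cycle is a path on at least three vertices whose ends are adjacent.
  Cycle : Set
  Cycle = ∃[ u ] ∃[ v ] Σ[ p ∈ Walk u v ] IsPath p × 3 ≤ length (vertices p) × v ~ u

  IsTree : Set
  IsTree = 1 ≤ n × Connected × ¬ Cycle

  -- A map on unordered edges is encoded as a function on ordered pairs that is
  -- symmetric on edges; its values at non-adjacent pairs are never used.
  record EdgeColouring : Set where
    field
      colour     : Fin n → Fin n → ℕ
      colour-sym : ∀ {u v} → u ~ v → colour u v ≡ colour v u

  module _ (c : EdgeColouring) where
    open EdgeColouring c

    numColours : ℕ
    numColours = length (deduplicate ℕ._≟_ (map (λ (u , v) → colour u v) edges))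

    edgeColours : ∀ {u v} → Walk u v → List ℕ
    edgeColours ε                   = []
    edgeColours (_◅_ {u} {v} _ p) = colour u v ∷ edgeColours p

    -- Between the i-th and the j-th edge of a path, i < j, lie j - i - 1 edges.
    Distance2Proper : ∀ {u v} → Walk u v → Set
    Distance2Proper p = IsPath p ×
      (∀ i j → i < j → lookup (edgeColours p) i ≡ lookup (edgeColours p) j →
       2 ≤ toℕ j ∸ suc (toℕ i))

    Distance2ProperConnected : Set
    Distance2ProperConnected =
      ∀ u v → u ≢ v → Σ[ p ∈ Walk u v ] Distance2Proper p

  -- "pc₁,₂(G) = k": the minimum is specified as a relation, since to name it as
  -- a number one must first show that some colouring qualifies.
  pc₁,₂≡ : ℕ → Set
  pc₁,₂≡ k =
    (∃[ c ] Distance2ProperConnected c × numColours c ≡ k) ×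
    (∀ c → Distance2ProperConnected c → k ≤ numColours c)

{-# OPTIONS --safe #-}
module Submission where

-- In a tree every path is the unique one between its ends, so a colouring
-- qualifies iff it is a strong edge colouring: edges that meet or are joined by
-- an edge get different colours.  The d(x) + d(y) - 1 edges meeting an edge xy
-- are pairwise of this kind, whence the lower bound.  For the upper bound, root
-- the tree and colour greedily by increasing depth.  When the edge from v to
-- its parent u is reached, the coloured edges in conflict with it are incident
-- with u or with the parent p of u, and there are at most d(u) + d(p) - 2 of them.

open import Data.Nat.Base using (ℕ; zero; suc; _+_; _∸_; _≤_; _<_; z≤n; s≤s; s≤s⁻¹)
import Data.Nat.Properties as ℕ
open import Data.Fin.Base using (Fin; zero; suc; toℕ)
import Data.Fin.Base as F
import Data.Fin.Properties as Fin
open import Data.Bool.Base using (if_then_else_)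
open import Data.List.Base
  using (List; []; _∷_; _++_; length; lookup; map; filter; deduplicate; allFin; cartesianProduct; upTo)
open import Data.List.Properties
  using (length-++; length-map; length-upTo; filter-notAll)
import Data.List.Extrema.Nat as Extrema
open import Data.List.Membership.DecPropositional ℕ._≟_ using (_∈?_)
open import Data.List.Membership.Propositional using (_∈_; _∉_; find; lose)
open import Data.List.Membership.Propositional.Properties
open import Data.List.Relation.Binary.Subset.Propositional using (_⊆_)
open import Data.List.Relation.Binary.Permutation.Propositional using (↭-sym; ↭⇒↭ₛ)
open import Data.List.Relation.Binary.Permutation.Propositional.Properties using (∈-resp-↭)
import Data.List.Relation.Binary.Permutation.Setoid.Properties as Permₛ
open import Data.List.Relation.Unary.All as All using (All; []; _∷_)
import Data.List.Relation.Unary.All.Properties as All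
open import Data.List.Relation.Unary.AllPairs as AllPairs using (AllPairs; []; _∷_)
open import Data.List.Relation.Unary.Any as Any using (here; there)
open import Data.List.Relation.Unary.Sorted.TotalOrder.Properties using (Sorted⇒AllPairs)
open import Data.List.Relation.Unary.Unique.Propositional using (Unique)
import Data.List.Relation.Unary.Unique.Propositional.Properties as Unique
import Data.List.Relation.Unary.Unique.DecPropositional.Properties as DecUnique
import Data.List.Sort as Sort
open import Data.Product.Base using (_×_; _,_; proj₁; proj₂; ∃-syntax; Σ-syntax; uncurry)
open import Data.Sum.Base using (_⊎_; inj₁; inj₂)
open import Function.Base using (_∘_)
open import Relation.Binary.Bundles using (DecTotalOrder)
import Relation.Binary.Construct.Flip.EqAndOrd as Flip
import Relation.Binary.Construct.On as On
open import Relation.Binary.Construct.Closure.ReflexiveTransitive using (ε; _◅_)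
open import Relation.Binary.Core using (Rel)
open import Relation.Binary.Definitions using (DecidableEquality; tri<; tri≈; tri>)
open import Relation.Binary.PropositionalEquality
  using (_≡_; _≢_; refl; sym; trans; cong; subst; subst₂; ≢-sym; setoid; module ≡-Reasoning)
open import Relation.Nullary using (¬_; Dec; yes; no; does; contradiction)
open import Relation.Nullary.Decidable using (¬?; dec-true; dec-false; decidable-stable)
open import Level using (0ℓ)
open import Defs

-- Pigeonhole and greedy colouring on lists.

module _ {A : Set} (_≟_ : DecidableEquality A) where

  -- Deleting the head `x` from `ys` shortens `ys` strictly, and the tail `xs`, which avoids `x`, is
  -- still contained in what remains.
  Unique⊆⇒length≤ : ∀ {xs ys : List A} → Unique xs → xs ⊆ ys → length xs ≤ length ys
  Unique⊆⇒length≤ {[]} _ _ = z≤n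
  Unique⊆⇒length≤ {x ∷ xs} {ys} (x∉xs ∷ xs!) xs⊆ys =
    ℕ.≤-<-trans (Unique⊆⇒length≤ xs! xs⊆ys-x)
      (filter-notAll x≢? ys (lose (xs⊆ys (here refl)) λ x≢x → x≢x refl))
    where
    x≢? : ∀ y → Dec (y ≢ x)
    x≢? y = ¬? (y ≟ x)
    xs⊆ys-x : xs ⊆ filter x≢? ys
    xs⊆ys-x y∈xs = ∈-filter⁺ x≢? (xs⊆ys (there y∈xs)) (≢-sym (All.lookup x∉xs y∈xs))

AllPairs-lookup : ∀ {A : Set} {R : Rel A 0ℓ} {xs : List A} {x y} →
  AllPairs R xs → x ∈ xs → y ∈ xs → x ≢ y → R x y ⊎ R y x
AllPairs-lookup (_ ∷ _)  (here refl) (here refl) x≢y = contradiction refl x≢y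
AllPairs-lookup (r ∷ _)  (here refl) (there y∈)  _   = inj₁ (All.lookup r y∈)
AllPairs-lookup (r ∷ _)  (there x∈)  (here refl) _   = inj₂ (All.lookup r x∈)
AllPairs-lookup (_ ∷ rs) (there x∈)  (there y∈)  x≢y = AllPairs-lookup rs x∈ y∈ x≢y

-- Pigeonhole: if every `c < k` occurred in `xs`, the `k` distinct entries of `upTo k` would force
-- `k ≤ length xs`.
fresh : ∀ {k} (xs : List ℕ) → length xs < k → ∃[ c ] c < k × c ∉ xs
fresh {k} xs ∣xs∣<k with All.search (λ c → ¬? (c ∈? xs)) (upTo k)
... | inj₂ some∉xs = let c , c∈ , c∉xs = find some∉xs in c , ∈-upTo⁻ c∈ , c∉xs
... | inj₁ all∈xs = contradiction k≤∣xs∣ (ℕ.<⇒≱ ∣xs∣<k)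
  where
  upTo⊆xs : upTo k ⊆ xs
  upTo⊆xs {c} c∈ = decidable-stable (c ∈? xs) (All.lookup all∈xs c∈)
  k≤∣xs∣ : k ≤ length xs
  k≤∣xs∣ = subst (_≤ length xs) (length-upTo k) (Unique⊆⇒length≤ ℕ._≟_ (Unique.upTo⁺ k) upTo⊆xs)

module _ {A : Set} (_≟_ : DecidableEquality A) (M : A → List A) {k : ℕ} where

  -- The list is coloured from its end: the head `x` takes a colour below `k` that is missing from
  -- the current values on `M x`, and the entries after it keep theirs. Hence an entry is only
  -- guaranteed to differ from those of its conflicts that come after it.
  greedyColouring : ∀ {xs} → Unique xs → All (λ x → length (M x) < k) xs →
    ∃[ f ] All (λ x → f x < k) xs × AllPairs (λ x y → y ∈ M x → f x ≢ f y) xs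
  greedyColouring [] [] = (λ _ → 0) , [] , []
  greedyColouring {x ∷ xs} (x∉xs ∷ xs!) (Mx<k ∷ Mxs<k)
    with f , f<k , f-proper ← greedyColouring xs! Mxs<k
    with c , c<k , c∉ ← fresh (map f (M x)) (subst (_< k) (sym (length-map f (M x))) Mx<k)
    = g , subst (_< k) (sym gx≡c) c<k ∷ All.zipWith (λ (eq , lt) → subst (_< k) (sym eq) lt) (g≡f , f<k)
    , All.map (λ {y} gy≡fy y∈M gx≡gy →
        c∉ (subst (_∈ map f (M x)) (trans (sym gy≡fy) (trans (sym gx≡gy) gx≡c)) (∈-map⁺ f y∈M))) g≡f
      ∷ transport g≡f f-proper
    where
    g : A → ℕ
    g y = if does (x ≟ y) then c else f y

    gx≡c : g x ≡ c
    gx≡c = cong (λ b → if b then c else f x) (dec-true (x ≟ x) refl)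

    g≡f : All (λ y → g y ≡ f y) xs
    g≡f = All.map (λ {y} x≢y → cong (λ b → if b then c else f y) (dec-false (x ≟ y) x≢y)) x∉xs

    transport : ∀ {ys} → All (λ y → g y ≡ f y) ys →
      AllPairs (λ y z → z ∈ M y → f y ≢ f z) ys → AllPairs (λ y z → z ∈ M y → g y ≢ g z) ys
    transport [] [] = []
    transport (eq ∷ eqs) (p ∷ ps) =
      All.zipWith (λ (eq′ , ne) z∈M → subst₂ _≢_ (sym eq) (sym eq′) (ne z∈M)) (eqs , p) ∷ transport eqs ps

-- Neighbourhoods, degrees and edges.

module _ {n : ℕ} (G : Graph n) where
  open Graph G

  ~⇒≢ : ∀ {u v} → u ~ v → u ≢ v
  ~⇒≢ u~v refl = ~-irr u~v

  neighbours : Fin n → List (Fin n)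
  neighbours u = filter (u ~?_) (allFin n)

  ∈-neighbours⁺ : ∀ {u v} → u ~ v → v ∈ neighbours u
  ∈-neighbours⁺ {u} {v} u~v = ∈-filter⁺ (u ~?_) (∈-allFin v) u~v

  ∈-neighbours⁻ : ∀ {u v} → v ∈ neighbours u → u ~ v
  ∈-neighbours⁻ {u} v∈ = proj₂ (∈-filter⁻ (u ~?_) {xs = allFin n} v∈)

  neighbours! : ∀ u → Unique (neighbours u)
  neighbours! u = Unique.filter⁺ (u ~?_) (Unique.allFin⁺ n)

  otherNeighbours : Fin n → Fin n → List (Fin n)
  otherNeighbours u v = filter (λ x → ¬? (x Fin.≟ v)) (neighbours u)

  ∈-otherNeighbours⁺ : ∀ {u v x} → u ~ x → x ≢ v → x ∈ otherNeighbours u v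
  ∈-otherNeighbours⁺ u~x x≢v = ∈-filter⁺ _ (∈-neighbours⁺ u~x) x≢v

  ∈-otherNeighbours⁻ : ∀ {u v x} → x ∈ otherNeighbours u v → u ~ x × x ≢ v
  ∈-otherNeighbours⁻ {u} x∈ = let x∈N , x≢v = ∈-filter⁻ _ {xs = neighbours u} x∈ in ∈-neighbours⁻ x∈N , x≢v

  length-otherNeighbours : ∀ {u v} → u ~ v → length (otherNeighbours u v) < degree G u
  length-otherNeighbours {u} u~v = filter-notAll _ (neighbours u) (lose (∈-neighbours⁺ u~v) λ v≢v → v≢v refl)

  degree≤1+otherNeighbours : ∀ u v → degree G u ≤ suc (length (otherNeighbours u v))
  degree≤1+otherNeighbours u v = Unique⊆⇒length≤ Fin._≟_ (neighbours! u) split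
    where
    split : neighbours u ⊆ v ∷ otherNeighbours u v
    split {x} x∈ with x Fin.≟ v
    ... | yes refl = here refl
    ... | no  x≢v  = there (∈-filter⁺ _ x∈ x≢v)

  ∈-edges⁺ : ∀ {u v} → u F.< v → u ~ v → (u , v) ∈ edges G
  ∈-edges⁺ {u} {v} u<v u~v =
    ∈-filter⁺ _ (∈-cartesianProduct⁺ (∈-allFin u) (∈-allFin v)) (u<v , u~v)

  ∈-edges⁻ : ∀ {u v} → (u , v) ∈ edges G → u ~ v
  ∈-edges⁻ e∈ = proj₂ (proj₂ (∈-filter⁻ _ {xs = cartesianProduct (allFin n) (allFin n)} e∈))

  -- Since `edges` lists an edge only with its smaller endpoint first, the symmetry of `f` is what
  -- covers the other orientation.
  ~⇒∈-map-edges : ∀ {B : Set} (f : Fin n → Fin n → B) → (∀ {u v} → u ~ v → f u v ≡ f v u) →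
    ∀ {u v} → u ~ v → f u v ∈ map (λ (x , y) → f x y) (edges G)
  ~⇒∈-map-edges f f-sym {u} {v} u~v with Fin.<-cmp u v
  ... | tri< u<v _ _ = ∈-map⁺ (uncurry f) (∈-edges⁺ u<v u~v)
  ... | tri≈ _ u≡v _ = contradiction u≡v (~⇒≢ u~v)
  ... | tri> _ _ v<u = subst (_∈ map (uncurry f) (edges G)) (sym (f-sym u~v)) (∈-map⁺ (uncurry f) (∈-edges⁺ v<u (~-sym u~v)))

  degree+degree≤σ₂′ : ∀ {u v} → u ~ v → degree G u + degree G v ≤ σ₂′ G
  degree+degree≤σ₂′ u~v = All.lookup (Extrema.xs≤max 0 _)
    (~⇒∈-map-edges (λ x y → degree G x + degree G y) (λ {x} {y} _ → ℕ.+-comm (degree G x) (degree G y)) u~v)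

  -- The first alternative accounts for the default value of `max`.
  σ₂′-attained : σ₂′ G ≡ 0 ⊎ (∃[ x ] ∃[ y ] x ~ y × σ₂′ G ≡ degree G x + degree G y)
  σ₂′-attained with Extrema.argmax-sel (λ m → m) 0 (map (λ (x , y) → degree G x + degree G y) (edges G))
  ... | inj₁ eq = inj₁ eq
  ... | inj₂ σ∈ with (x , y) , e∈ , eq ← ∈-map⁻ _ σ∈ = inj₂ (x , y , ∈-edges⁻ e∈ , eq)

  -- Walks, loop erasure and walks inside a vertex set.

  start∈vertices : ∀ {u v} (p : Walk G u v) → u ∈ vertices G p
  start∈vertices ε       = here refl
  start∈vertices (_ ◅ _) = here refl

  end∈vertices : ∀ {u v} (p : Walk G u v) → v ∈ vertices G p
  end∈vertices ε       = here refl
  end∈vertices (_ ◅ p) = there (end∈vertices p)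

  suffix : ∀ {u v x} (p : Walk G u v) → IsPath G p → x ∈ vertices G p →
    Σ[ q ∈ Walk G x v ] IsPath G q × vertices G q ⊆ vertices G p
  suffix ε       p!        (here refl) = ε , p! , λ y∈ → y∈
  suffix (e ◅ p) p!        (here refl) = e ◅ p , p! , λ y∈ → y∈
  suffix (e ◅ p) (_ ∷ p!) (there x∈)  = let q , q! , q⊆p = suffix p p! x∈ in q , q! , there ∘ q⊆p

  prefix : ∀ {u v x} (p : Walk G u v) → x ∈ vertices G p →
    Σ[ q ∈ Walk G u x ] vertices G q ⊆ vertices G p
  prefix ε       (here refl) = ε , λ y∈ → y∈
  prefix (_ ◅ _) (here refl) = ε , λ { (here y≡) → here y≡ }
  prefix (e ◅ p) (there x∈)  = let q , q⊆p = prefix p x∈ in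
    e ◅ q , λ { (here y≡) → here y≡ ; (there y∈) → there (q⊆p y∈) }

  -- If `u` recurs on the erased remainder, the suffix from that occurrence replaces the whole walk.
  -- The inclusion of vertices ensures that a vertex avoided by the walk is avoided by the path.
  loopErasure : ∀ {u v} (p : Walk G u v) →
    Σ[ q ∈ Walk G u v ] IsPath G q × vertices G q ⊆ vertices G p
  loopErasure ε = ε , [] ∷ [] , λ y∈ → y∈
  loopErasure {u} (e ◅ p) with q , q! , q⊆p ← loopErasure p with Any.any? (u Fin.≟_) (vertices G q)
  ... | yes u∈q = let q′ , q′! , q′⊆q = suffix q q! u∈q in q′ , q′! , there ∘ q⊆p ∘ q′⊆q
  ... | no  u∉q = e ◅ q , All.¬Any⇒All¬ _ u∉q ∷ q!
                , λ { (here y≡) → here y≡ ; (there y∈) → there (q⊆p y∈) }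

  infix 4 _⟨_⟩_
  -- With `u ≢_` as `P`, this is connection in the graph with `u` deleted.
  _⟨_⟩_ : Fin n → (Fin n → Set) → Fin n → Set
  u ⟨ P ⟩ v = Σ[ p ∈ Walk G u v ] All P (vertices G p)

  within-trans : ∀ {P u v w} → u ⟨ P ⟩ v → v ⟨ P ⟩ w → u ⟨ P ⟩ w
  within-trans (ε , _) q = q
  within-trans (e ◅ p , Pu ∷ Pp) q = let r , Pr = within-trans (p , Pp) q in e ◅ r , Pu ∷ Pr

  within-sym : ∀ {P u v} → u ⟨ P ⟩ v → v ⟨ P ⟩ u
  within-sym (ε , Pu) = ε , Pu
  within-sym (e ◅ p , Pu ∷ Pp) =
    within-trans (within-sym (p , Pp)) (~-sym e ◅ ε , All.lookup Pp (start∈vertices p) ∷ Pu ∷ [])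

  -- Strong edge colourings.

  module _ (c : EdgeColouring G) where
    open EdgeColouring c

    Spaced : List ℕ → Set
    Spaced cs = ∀ i j → i F.< j → lookup cs i ≡ lookup cs j → 2 ≤ toℕ j ∸ suc (toℕ i)

    -- Computed from vertices alone, so that walks with equal vertex lists but different adjacency
    -- proofs have equal colour lists.
    coloursAlong : List (Fin n) → List ℕ
    coloursAlong []           = []
    coloursAlong (_ ∷ [])     = []
    coloursAlong (u ∷ v ∷ vs) = colour u v ∷ coloursAlong (v ∷ vs)

    edgeColours≡coloursAlong : ∀ {u v} (p : Walk G u v) →
      edgeColours G c p ≡ coloursAlong (vertices G p)
    edgeColours≡coloursAlong ε               = refl
    edgeColours≡coloursAlong (_ ◅ ε)         = refl
    edgeColours≡coloursAlong (_ ◅ p@(_ ◅ _)) = cong (_ ∷_) (edgeColours≡coloursAlong p)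

    -- In the second clause `w` and `z` may coincide; the two edges then lie in a triangle.
    IsStrong : Set
    IsStrong =
      (∀ {x y z} → x ~ y → y ~ z → x ≢ z → colour x y ≢ colour y z) ×
      (∀ {w x y z} → w ~ x → x ~ y → y ~ z → w ≢ y → x ≢ z → colour w x ≢ colour y z)

    -- Dropping the first edge shifts both indices alike, so only pairs with the first edge matter.
    -- The two clauses of `IsStrong` settle the second and third edges, and any later edge is far
    -- enough away.
    strong⇒spaced : IsStrong → ∀ {u v} (p : Walk G u v) → IsPath G p → Spaced (edgeColours G c p)
    strong⇒spaced s ε _ () _ _
    strong⇒spaced s (_ ◅ p) (_ ∷ p!) (suc i) (suc j) (s≤s i<j) eq = strong⇒spaced s p p! i j i<j eq
    strong⇒spaced s (e ◅ f ◅ p) ((_ ∷ u∉p) ∷ _) zero (suc zero) _ eq =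
      contradiction eq (proj₁ s e f (All.lookup u∉p (start∈vertices p)))
    strong⇒spaced s (e ◅ f ◅ g ◅ p) ((_ ∷ u≢ ∷ _) ∷ (_ ∷ v∉p) ∷ _) zero (suc (suc zero)) _ eq =
      contradiction eq (proj₂ s e f g u≢ (All.lookup v∉p (start∈vertices p)))
    strong⇒spaced s (_ ◅ _ ◅ _ ◅ _) _ zero (suc (suc (suc _))) _ _ = s≤s (s≤s z≤n)

    strong⇒connected : Connected G → IsStrong → Distance2ProperConnected G c
    strong⇒connected conn s u v _ =
      let p , p! , _ = loopErasure (conn u v) in p , p! , strong⇒spaced s p p!

-- Uniqueness of paths in acyclic graphs.

module Tree {n : ℕ} (T : Graph n) (acyclic : ¬ Cycle T) where
  open Graph T

  -- Otherwise u closes a cycle with a path from a to b.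
  sameBranch : ∀ {u a b} → u ~ a → u ~ b → _⟨_⟩_ T a (u ≢_) b → a ≡ b
  sameBranch u~a u~b (p , u∉p) with loopErasure T p
  ... | ε , _ = refl
  ... | q@(_ ◅ q′) , q! , q⊆p =
    contradiction (_ , _ , u~a ◅ q , All.tabulate (All.lookup u∉p ∘ q⊆p) ∷ q! , long q′ , ~-sym u~b) acyclic
    where
    long : ∀ {x y} (r : Walk T x y) → 3 ≤ suc (suc (length (vertices T r)))
    long ε       = s≤s (s≤s (s≤s z≤n))
    long (_ ◅ _) = s≤s (s≤s (s≤s z≤n))

  -- The two remainders avoid `u` and share their end, so together they join the two second vertices
  -- without `u`; by `sameBranch` these vertices agree.
  path-unique : ∀ {u v} (p q : Walk T u v) → IsPath T p → IsPath T q → vertices T p ≡ vertices T q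
  path-unique ε ε _ _ = refl
  path-unique ε (_ ◅ q) _ (u∉q ∷ _) = contradiction refl (All.lookup u∉q (end∈vertices T q))
  path-unique (_ ◅ p) ε (u∉p ∷ _) _ = contradiction refl (All.lookup u∉p (end∈vertices T p))
  path-unique (e ◅ p) (f ◅ q) (u∉p ∷ p!) (u∉q ∷ q!)
    with refl ← sameBranch e f (within-trans T (p , u∉p) (within-sym T (q , u∉q))) =
    cong (_ ∷_) (path-unique p q p! q!)

  -- The lower bound.

  module _ (c : EdgeColouring T) (d2pc : Distance2ProperConnected T c) where
    open EdgeColouring c

    -- The hypothesis supplies only some proper path between the ends; by uniqueness it has the
    -- vertices of `p`.
    path-spaced : ∀ {u v} (p : Walk T u v) → IsPath T p → u ≢ v → Spaced T c (edgeColours T c p)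
    path-spaced p p! u≢v with q , q! , q-spaced ← d2pc _ _ u≢v = subst (Spaced T c) eq q-spaced
      where
      open ≡-Reasoning
      eq : edgeColours T c q ≡ edgeColours T c p
      eq = begin
        edgeColours T c q                 ≡⟨ edgeColours≡coloursAlong T c q ⟩
        coloursAlong T c (vertices T q)   ≡⟨ cong (coloursAlong T c) (path-unique q p q! p!) ⟩
        coloursAlong T c (vertices T p)   ≡⟨ sym (edgeColours≡coloursAlong T c p) ⟩
        edgeColours T c p                 ∎

    connected⇒strong : IsStrong T c
    connected⇒strong = adjacent , joined
      where
      adjacent : ∀ {x y z} → x ~ y → y ~ z → x ≢ z → colour x y ≢ colour y z
      -- No edge lies in between, so equal colours would give `2 ≤ 0`.
      adjacent x~y y~z x≢z eq with () ← path-spaced (x~y ◅ y~z ◅ ε)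
        ((~⇒≢ T x~y ∷ x≢z ∷ []) ∷ (~⇒≢ T y~z ∷ []) ∷ [] ∷ []) x≢z zero (suc zero) (s≤s z≤n) eq
      joined : ∀ {w x y z} → w ~ x → x ~ y → y ~ z → w ≢ y → x ≢ z → colour w x ≢ colour y z
      -- One edge lies in between, so equal colours would give `2 ≤ 1`.
      joined {w} {x} {y} {z} w~x x~y y~z w≢y x≢z eq with s≤s⁻¹ (path-spaced (w~x ◅ x~y ◅ y~z ◅ ε)
        ((~⇒≢ T w~x ∷ w≢y ∷ w≢z ∷ []) ∷ (~⇒≢ T x~y ∷ x≢z ∷ []) ∷ (~⇒≢ T y~z ∷ []) ∷ [] ∷ [])
        w≢z zero (suc (suc zero)) (s≤s z≤n) eq)
        where
        w≢z : w ≢ z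
        -- Otherwise `w` and `y` would be adjacent neighbours of `x`, closing a triangle.
        w≢z refl = w≢y (sameBranch (~-sym w~x) x~y
          (~-sym y~z ◅ ε , ~⇒≢ T (~-sym w~x) ∷ ~⇒≢ T x~y ∷ []))
      ... | ()

    σ₂′-1≤numColours : σ₂′ T ∸ 1 ≤ numColours T c
    σ₂′-1≤numColours with σ₂′-attained T
    ... | inj₁ σ≡0 rewrite σ≡0 = z≤n
    ... | inj₂ (x , y , x~y , σ≡) = ℕ.≤-trans σ-1≤
      (Unique⊆⇒length≤ ℕ._≟_ (Unique.++⁺ xs! ys! disjoint) (∈-deduplicate⁺ ℕ._≟_ ∘ used))
      where
      -- The edge `xy` is counted at `x` only, whence the subtraction of 1.
      xs ys : List ℕ
      xs = map (colour x) (neighbours T x)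
      ys = map (colour y) (otherNeighbours T y x)

      star! : ∀ {z vs} → (∀ {v} → v ∈ vs → z ~ v) → Unique vs → Unique (map (colour z) vs)
      star! z~ [] = []
      star! z~ (v∉vs ∷ vs!) = All.map⁺ (All.tabulate λ w∈ eq →
          proj₁ connected⇒strong (~-sym (z~ (here refl))) (z~ (there w∈)) (All.lookup v∉vs w∈)
            (trans (sym (colour-sym (z~ (here refl)))) eq))
        ∷ star! (z~ ∘ there) vs!

      xs! : Unique xs
      xs! = star! (∈-neighbours⁻ T) (neighbours! T x)
      ys! : Unique ys
      ys! = star! (proj₁ ∘ ∈-otherNeighbours⁻ T) (Unique.filter⁺ _ (neighbours! T y))

      disjoint : ∀ {k} → ¬ (k ∈ xs × k ∈ ys)
      disjoint (k∈xs , k∈ys)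
        with a , a∈ , refl ← ∈-map⁻ (colour x) k∈xs | b , b∈ , eq ← ∈-map⁻ (colour y) k∈ys
        with x~a ← ∈-neighbours⁻ T a∈ | y~b , b≢x ← ∈-otherNeighbours⁻ T b∈
        -- The edges `xa` and `yb` meet at `y` if `a` is `y`; otherwise `xy` joins them.
        with a Fin.≟ y
      ... | yes refl = proj₁ connected⇒strong x~y y~b (≢-sym b≢x) eq
      ... | no  a≢y  = proj₂ connected⇒strong (~-sym x~a) x~y y~b a≢y (≢-sym b≢x)
                         (trans (sym (colour-sym x~a)) eq)

      used : ∀ {k} → k ∈ xs ++ ys → k ∈ map (λ (u , v) → colour u v) (edges T)
      used k∈ with ∈-++⁻ xs k∈
      ... | inj₁ k∈xs with a , a∈ , refl ← ∈-map⁻ (colour x) k∈xs =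
              ~⇒∈-map-edges T colour colour-sym (∈-neighbours⁻ T a∈)
      ... | inj₂ k∈ys with b , b∈ , refl ← ∈-map⁻ (colour y) k∈ys =
              ~⇒∈-map-edges T colour colour-sym (proj₁ (∈-otherNeighbours⁻ T b∈))

      σ-1≤ : σ₂′ T ∸ 1 ≤ length (xs ++ ys)
      σ-1≤ rewrite σ≡ | length-++ xs {ys} | length-map (colour x) (neighbours T x)
        | length-map (colour y) (otherNeighbours T y x) = begin
        degree T x + degree T y ∸ 1
          ≤⟨ ℕ.∸-monoˡ-≤ 1 (ℕ.+-monoʳ-≤ (degree T x) (degree≤1+otherNeighbours T y x)) ⟩
        degree T x + suc (length (otherNeighbours T y x)) ∸ 1
          ≡⟨ cong (_∸ 1) (ℕ.+-suc (degree T x) _) ⟩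
        degree T x + length (otherNeighbours T y x) ∎
        where open ℕ.≤-Reasoning

  -- Rooting the tree and orienting its edges.

  module Rooted (conn : Connected T) (r : Fin n) where

    route : ∀ v → Walk T v r
    route v = proj₁ (loopErasure T (conn v r))

    route! : ∀ v → IsPath T (route v)
    route! v = proj₁ (proj₂ (loopErasure T (conn v r)))

    trail : Fin n → List (Fin n)
    trail v = vertices T (route v)

    second : Fin n → List (Fin n) → Fin n
    second v (_ ∷ w ∷ _) = w
    second v _           = v

    -- The parent of the root is the root itself; hence v is not the root iff v ~ parent v.
    parent : Fin n → Fin n
    parent v = second v (trail v)

    depth : Fin n → ℕ
    depth v = length (trail v)

    -- The condition on depths keeps the root from being its own child.
    _isChildOf_ : Fin n → Fin n → Set
    v isChildOf u = parent v ≡ u × depth v ≡ suc (depth u)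

    extends⇒child : ∀ {u v} → trail v ≡ v ∷ trail u → v isChildOf u
    extends⇒child {u} {v} eq rewrite eq = second≡ (route u) , refl
      where
      second≡ : ∀ {x y} (p : Walk T x y) → second v (v ∷ vertices T p) ≡ x
      second≡ ε       = refl
      second≡ (_ ◅ _) = refl

    -- The second vertex of `p` is joined to `v` by a part of `p` that avoids `u`, so by
    -- `sameBranch` it is `v`; the rest is then the unique path from `v` to the root.
    passes⇒extends : ∀ {u v} (p : Walk T u r) → IsPath T p → v ~ u → v ∈ vertices T p →
      vertices T p ≡ u ∷ trail v
    passes⇒extends ε       _ v~u (here refl) = contradiction v~u ~-irr
    passes⇒extends (_ ◅ _) _ v~u (here refl) = contradiction v~u ~-irr
    passes⇒extends (e ◅ p) (u∉p ∷ p!) v~u (there v∈p)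
      with q , q⊆p ← prefix T p v∈p
      with refl ← sameBranch e (~-sym v~u) (q , All.tabulate (All.lookup u∉p ∘ q⊆p)) =
      cong (_ ∷_) (path-unique p (route _) p! (route! _))

    -- If `v` lies on the trail of `u`, that trail goes straight to `v`; if not, putting `v` in
    -- front of it gives the trail of `v`.
    orient : ∀ {u v} → u ~ v → u isChildOf v ⊎ v isChildOf u
    orient {u} {v} u~v with Any.any? (v Fin.≟_) (trail u)
    ... | yes v∈ = inj₁ (extends⇒child (passes⇒extends (route u) (route! u) (~-sym u~v) v∈))
    ... | no  v∉ = inj₂ (extends⇒child
                     (path-unique (route v) (~-sym u~v ◅ route u) (route! v) (All.¬Any⇒All¬ _ v∉ ∷ route! u)))

    child⇒deeper : ∀ {u v} → v isChildOf u → depth u < depth v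
    child⇒deeper (_ , eq) = ℕ.≤-reflexive (sym eq)

    child⇒~parent : ∀ {u v} → v ~ u → v isChildOf u → v ~ parent v
    child⇒~parent v~u (refl , _) = v~u

    -- Edges as lower endpoints, and their conflicts.

    -- An edge is represented, and coloured, by its deeper endpoint.
    lower : Fin n → Fin n → Fin n
    lower u v = if does (depth u ℕ.<? depth v) then v else u

    lower-childʳ : ∀ {u v} → v isChildOf u → lower u v ≡ v
    lower-childʳ {u} {v} ch =
      cong (λ b → if b then v else u) (dec-true (depth u ℕ.<? depth v) (child⇒deeper ch))

    lower-childˡ : ∀ {u v} → v isChildOf u → lower v u ≡ v
    lower-childˡ {u} {v} ch =
      cong (λ b → if b then u else v) (dec-false (depth v ℕ.<? depth u) (ℕ.<-asym (child⇒deeper ch)))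

    lower-sym : ∀ {u v} → u ~ v → lower u v ≡ lower v u
    lower-sym u~v with orient u~v
    ... | inj₁ ch = trans (lower-childˡ ch) (sym (lower-childʳ ch))
    ... | inj₂ ch = trans (lower-childʳ ch) (sym (lower-childˡ ch))

    lower~parent : ∀ {u v} → u ~ v → lower u v ~ parent (lower u v)
    lower~parent u~v with orient u~v
    ... | inj₁ ch rewrite lower-childˡ ch = child⇒~parent u~v ch
    ... | inj₂ ch rewrite lower-childʳ ch = child⇒~parent (~-sym u~v) ch

    otherEdges : Fin n → Fin n → List (Fin n)
    otherEdges u v = map (lower u) (otherNeighbours T u v)

    ∈-otherEdges⁺ : ∀ {u v x} → u ~ x → x ≢ v → lower u x ∈ otherEdges u v
    ∈-otherEdges⁺ {u} u~x x≢v = ∈-map⁺ (lower u) (∈-otherNeighbours⁺ T u~x x≢v)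

    length-otherEdges : ∀ {u v} → u ~ v → length (otherEdges u v) < degree T u
    length-otherEdges {u} {v} u~v =
      subst (_< degree T u) (sym (length-map (lower u) (otherNeighbours T u v))) (length-otherNeighbours T u~v)

    -- The default `[]` is for the root, which has no edge above it.
    edgesAbove : Fin n → List (Fin n)
    edgesAbove u = if does (u ~? parent u) then otherEdges (parent u) u else []

    -- Only edges that are not deeper than the one above v are listed; those of the
    -- same depth are the siblings of v, for which the relation is symmetric.
    conflicts : Fin n → List (Fin n)
    conflicts v = otherEdges (parent v) v ++ edgesAbove (parent v)

    length-conflicts : ∀ v → v ~ parent v → length (conflicts v) < σ₂′ T ∸ 1
    length-conflicts v v~u rewrite length-++ (otherEdges (parent v) v) {edgesAbove (parent v)}
      with parent v ~? parent (parent v)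
    -- Each of the two lists omits one edge at its vertex; these two omissions give the strict bound
    -- below `σ₂′ T ∸ 1`.
    ... | yes u~p = ℕ.m+n≤o⇒m≤o∸n _ (begin
      suc (a + b) + 1     ≡⟨ ℕ.+-comm _ 1 ⟩
      suc (suc (a + b))   ≡⟨ cong suc (sym (ℕ.+-suc a b)) ⟩
      suc a + suc b       ≤⟨ ℕ.+-mono-≤ (length-otherEdges (~-sym v~u)) (length-otherEdges (~-sym u~p)) ⟩
      degree T (parent v) + degree T (parent (parent v)) ≤⟨ degree+degree≤σ₂′ T u~p ⟩
      σ₂′ T ∎)
      where
      open ℕ.≤-Reasoning
      a b : ℕ
      a = length (otherEdges (parent v) v)
      b = length (otherEdges (parent (parent v)) (parent v))
    -- Here `parent v` is the root. The edge from `v` to it takes the place of the missing edge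
    -- above, with `degree T v` at least 1.
    ... | no _ = ℕ.m+n≤o⇒m≤o∸n _ (begin
      suc (a + 0) + 1     ≡⟨ cong (λ m → suc m + 1) (ℕ.+-identityʳ a) ⟩
      suc a + 1           ≤⟨ ℕ.+-mono-≤ (length-otherEdges (~-sym v~u)) (ℕ.≤-<-trans z≤n (length-otherEdges v~u)) ⟩
      degree T (parent v) + degree T v ≤⟨ degree+degree≤σ₂′ T (~-sym v~u) ⟩
      σ₂′ T ∎)
      where
      open ℕ.≤-Reasoning
      a : ℕ
      a = length (otherEdges (parent v) v)

    ∈-conflicts₁ : ∀ {v u x} → v isChildOf u → u ~ x → x ≢ v → lower u x ∈ conflicts v
    ∈-conflicts₁ (refl , _) u~x x≢v = ∈-++⁺ˡ (∈-otherEdges⁺ u~x x≢v)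

    ∈-conflicts₂ : ∀ {v u p x} → v isChildOf u → u ~ p → u isChildOf p → p ~ x → x ≢ u →
      lower p x ∈ conflicts v
    ∈-conflicts₂ {v} (refl , _) u~p (refl , _) p~x x≢u = ∈-++⁺ʳ (otherEdges (parent v) v) above
      where
      above : lower (parent (parent v)) _ ∈ edgesAbove (parent v)
      above with parent v ~? parent (parent v)
      ... | yes _  = ∈-otherEdges⁺ p~x x≢u
      ... | no u≁p = contradiction u~p u≁p

    -- Greedy labelling by increasing depth.

    -- greedyColouring starts from the end of its list.
    deepestFirst : DecTotalOrder _ _ _
    deepestFirst = Flip.decTotalOrder (On.decTotalOrder ℕ.≤-decTotalOrder depth)

    nonRoot? : ∀ v → Dec (v ~ parent v)
    nonRoot? v = v ~? parent v

    open Sort deepestFirst using (sort; sort-↭; sort-↗)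

    nonRoots : List (Fin n)
    nonRoots = sort (filter nonRoot? (allFin n))

    nonRoots! : Unique nonRoots
    nonRoots! = Permₛ.Unique-resp-↭ (setoid (Fin n)) (↭⇒↭ₛ (↭-sym (sort-↭ _)))
      (Unique.filter⁺ nonRoot? (Unique.allFin⁺ n))

    ∈-nonRoots⁺ : ∀ {v} → v ~ parent v → v ∈ nonRoots
    ∈-nonRoots⁺ {v} v~ = ∈-resp-↭ (↭-sym (sort-↭ _)) (∈-filter⁺ nonRoot? (∈-allFin v) v~)

    ∈-nonRoots⁻ : ∀ {v} → v ∈ nonRoots → v ~ parent v
    ∈-nonRoots⁻ v∈ = proj₂ (∈-filter⁻ nonRoot? {xs = allFin n} (∈-resp-↭ (sort-↭ _) v∈))

    greedy : ∃[ f ] All (λ v → f v < σ₂′ T ∸ 1) nonRoots ×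
                    AllPairs (λ v w → w ∈ conflicts v → f v ≢ f w) nonRoots
    greedy = greedyColouring Fin._≟_ conflicts nonRoots!
      (All.tabulate λ {v} v∈ → length-conflicts v (∈-nonRoots⁻ v∈))

    label : Fin n → ℕ
    label = proj₁ greedy

    label< : ∀ {v} → v ~ parent v → label v < σ₂′ T ∸ 1
    label< v~ = All.lookup (proj₁ (proj₂ greedy)) (∈-nonRoots⁺ v~)

    -- The labelling separates `v` from a conflict `w` only when `v` precedes `w` in the list. A
    -- strictly smaller depth of `w` forces this order; failing that, the conflict has to hold both
    -- ways.
    label-proper : ∀ {v w} → v ~ parent v → w ~ parent w → v ≢ w → w ∈ conflicts v →
      depth w < depth v ⊎ v ∈ conflicts w → label v ≢ label w
    label-proper v~ w~ v≢w w∈ side with AllPairs-lookup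
      (AllPairs.zip (proj₂ (proj₂ greedy) , Sorted⇒AllPairs (DecTotalOrder.totalOrder deepestFirst) (sort-↗ _)))
      (∈-nonRoots⁺ v~) (∈-nonRoots⁺ w~) v≢w | side
    ... | inj₁ (proper , _) | _        = proper w∈
    ... | inj₂ (_ , v≤w) | inj₁ w<v    = contradiction v≤w (ℕ.<⇒≱ w<v)
    ... | inj₂ (proper , _) | inj₂ v∈  = ≢-sym (proper v∈)

    -- The resulting edge colouring is strong.

    colouring : EdgeColouring T
    colouring = record
      { colour     = λ u v → label (lower u v)
      ; colour-sym = λ u~v → cong label (lower-sym u~v)
      }

    open EdgeColouring colouring

    -- Either `z` is the parent of `y` and the second edge is shallower, or `x` and `z` are siblings
    -- and conflict with each other.
    adjacent-up : ∀ {x y z} → x ~ y → y ~ z → x ≢ z → x isChildOf y → colour x y ≢ colour y z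
    adjacent-up {x} {y} {z} x~y y~z x≢z xy rewrite lower-childˡ xy with orient y~z
    ... | inj₁ yz = label-proper (child⇒~parent x~y xy) (lower~parent y~z) x≢low low∈ (inj₁ low<x)
      where
      low∈ : lower y z ∈ conflicts x
      low∈ = ∈-conflicts₁ xy y~z (≢-sym x≢z)
      low<x : depth (lower y z) < depth x
      low<x rewrite lower-childˡ yz = child⇒deeper xy
      x≢low : x ≢ lower y z
      x≢low eq = ℕ.<-irrefl (cong depth (sym eq)) low<x
    ... | inj₂ zy rewrite lower-childʳ zy =
      label-proper (child⇒~parent x~y xy) (child⇒~parent (~-sym y~z) zy) x≢z
        (subst (_∈ conflicts x) (lower-childʳ zy) (∈-conflicts₁ xy y~z (≢-sym x≢z)))
        (inj₂ (subst (_∈ conflicts z) (lower-childʳ xy) (∈-conflicts₁ zy (~-sym x~y) x≢z)))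

    -- After two steps up, the edge `yz` is represented by `y` or by a sibling of `x`, in either
    -- case by a vertex shallower than `w`.
    joined-up : ∀ {w x y z} → w ~ x → x ~ y → y ~ z → x ≢ z → w isChildOf x → x isChildOf y →
      colour w x ≢ colour y z
    joined-up {w} {x} {y} {z} w~x x~y y~z x≢z wx xy rewrite lower-childˡ wx =
      label-proper (child⇒~parent w~x wx) (lower~parent y~z) (λ eq → ℕ.<-irrefl (cong depth (sym eq)) low<w)
        (∈-conflicts₂ wx x~y xy y~z (≢-sym x≢z)) (inj₁ low<w)
      where
      low≤x : depth (lower y z) ≤ depth x
      low≤x with orient y~z
      ... | inj₁ yz rewrite lower-childˡ yz = ℕ.<⇒≤ (child⇒deeper xy)
      ... | inj₂ (zy , z≡) rewrite lower-childʳ (zy , z≡) = ℕ.≤-reflexive (trans z≡ (sym (proj₂ xy)))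
      low<w : depth (lower y z) < depth w
      low<w = ℕ.≤-<-trans low≤x (child⇒deeper wx)

    -- Parents are unique, so a path never goes down and then up. A path of two edges thus starts
    -- upwards or ends downwards; one of three edges starts with two steps up or ends with two steps
    -- down. Reversal reduces the second case to the first.
    colour-strong : IsStrong T colouring
    colour-strong = adjacent , joined
      where
      adjacent : ∀ {x y z} → x ~ y → y ~ z → x ≢ z → colour x y ≢ colour y z
      adjacent x~y y~z x≢z eq with orient x~y | orient y~z
      ... | inj₁ xy | _       = adjacent-up x~y y~z x≢z xy eq
      ... | inj₂ _  | inj₂ zy = adjacent-up (~-sym y~z) (~-sym x~y) (≢-sym x≢z) zy
              (trans (colour-sym (~-sym y~z)) (trans (sym eq) (colour-sym x~y)))
      ... | inj₂ (y→x , _) | inj₁ (y→z , _) = x≢z (trans (sym y→x) y→z)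

      joined : ∀ {w x y z} → w ~ x → x ~ y → y ~ z → w ≢ y → x ≢ z → colour w x ≢ colour y z
      joined w~x x~y y~z w≢y x≢z eq with orient w~x | orient x~y | orient y~z
      ... | inj₁ wx | inj₁ xy | _ = joined-up w~x x~y y~z x≢z wx xy eq
      ... | _ | inj₂ yx | inj₂ zy = joined-up (~-sym y~z) (~-sym x~y) (~-sym w~x) (≢-sym w≢y) zy yx
              (trans (colour-sym (~-sym y~z)) (trans (sym eq) (colour-sym w~x)))
      ... | inj₂ (x→w , _) | inj₁ (x→y , _) | _ = w≢y (trans (sym x→w) x→y)
      ... | _ | inj₂ (y→x , _) | inj₁ (y→z , _) = x≢z (trans (sym y→x) y→z)

    numColours≤σ₂′-1 : numColours T colouring ≤ σ₂′ T ∸ 1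
    numColours≤σ₂′-1 = subst (numColours T colouring ≤_) (length-upTo (σ₂′ T ∸ 1))
      (Unique⊆⇒length≤ ℕ._≟_ (DecUnique.deduplicate-! ℕ._≟_ _) used⊆)
      where
      used⊆ : deduplicate ℕ._≟_ (map (λ (u , v) → colour u v) (edges T)) ⊆ upTo (σ₂′ T ∸ 1)
      used⊆ k∈ with (u , v) , e∈ , refl ← ∈-map⁻ _ (∈-deduplicate⁻ ℕ._≟_ _ k∈) =
        ∈-upTo⁺ (label< (lower~parent (∈-edges⁻ T e∈)))

theorem2p4 : ∀ {n : ℕ} (T : Graph n) → IsTree T → 2 ≤ n → pc₁,₂≡ T (σ₂′ T ∸ 1)
theorem2p4 {suc _} T (_ , conn , acyclic) _ =
  (colouring , d2pc , ℕ.≤-antisym numColours≤σ₂′-1 (σ₂′-1≤numColours colouring d2pc)) , σ₂′-1≤numColours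
  where
  open Tree T acyclic
  -- Any vertex can serve as the root.
  open Rooted conn zero
  d2pc : Distance2ProperConnected T colouring
  d2pc = strong⇒connected T colouring conn colour-strong
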